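{- The cactus groups $J_n$ have no odd torsion (no element of odd order greater than $1$). Moreover, for every $k\ge 1$, $J_n$ contains elements of order $2^k$ provided that $n$ is big enough.
   Context: For $n \ge 2$, the cactus group $J_n$ is the group with generators $s_{p,q}$ for $1 \le p < q \le n$ and relations: (j1) $s_{p,q}^2 = 1$; (j2) $s_{p,q}s_{m,r} = s_{m,r}s_{p,q}$ whenever $[p,q]\cap[m,r]=\emptyset$; (j3) $s_{p,q}s_{m,r} = s_{p+q-r,\,p+q-m}\,s_{p,q}$ whenever $[m,r]\subset[p,q]$ (intervals of integers). -}

module Defs where

open import Data.Nat using (ℕ; _+_; _∸_; _≤_; _<_; _*_)
open import Data.Nat.Properties using ()
open import Data.Product using (_×_; _,_; Σ)
open import Relation.Binary.PropositionalEquality using (_≡_)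
open import Data.Sum using (_⊎_)
open import Data.List using (List; []; _∷_; _++_; concat; replicate)
open import Data.List.Relation.Unary.All using (All)
open import Relation.Nullary using (¬_)
open import Relation.Binary.Construct.Closure.Equivalence using (EqClosure)

-- A letter (p , q) stands for the generator s_{p,q}.
Letter : Set
Letter = ℕ × ℕ

Valid : ℕ → Letter → Set
Valid n (p , q) = 1 ≤ p × p < q × q ≤ n

data Rel₀ (n : ℕ) : List Letter → List Letter → Set where
  j1 : ∀ {p q} → Valid n (p , q) →
       Rel₀ n ((p , q) ∷ (p , q) ∷ []) []
  -- [p,q] ∩ [m,r] = ∅  (with p<q, m<r) iff q < m or r < p
  j2 : ∀ {p q m r} → Valid n (p , q) → Valid n (m , r) → (q < m ⊎ r < p) →
       Rel₀ n ((p , q) ∷ (m , r) ∷ []) ((m , r) ∷ (p , q) ∷ [])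
  j3 : ∀ {p q m r} → Valid n (p , q) → Valid n (m , r) → p ≤ m → r ≤ q →
       Rel₀ n ((p , q) ∷ (m , r) ∷ [])
              ((p + q ∸ r , p + q ∸ m) ∷ (p , q) ∷ [])

data Step (n : ℕ) : List Letter → List Letter → Set where
  ctx : ∀ u v {l r} → Rel₀ n l r → Step n (u ++ l ++ v) (u ++ r ++ v)

_≈[_]_ : List Letter → ℕ → List Letter → Set
w ≈[ n ] w' = EqClosure (Step n) w w'

Word : ℕ → List Letter → Set
Word n w = All (Valid n) w

_^w_ : List Letter → ℕ → List Letter
w ^w k = concat (replicate k w)

HasOrder : ℕ → List Letter → ℕ → Set
HasOrder n w m =
  0 < m × (w ^w m) ≈[ n ] [] × (∀ k → 0 < k → k < m → ¬ ((w ^w k) ≈[ n ] []))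

OddN : ℕ → Set
OddN m = Σ ℕ λ j → m ≡ 1 + 2 * j

{-# OPTIONS --safe #-}

-- No odd torsion.  Map J_n to W ⋊ S_n with W a right-angled Coxeter group, and let |x| be the
-- length of the W-component of x.  This length satisfies a parallelogram law around the squares
-- of the Cayley graph given by (j2) and (j3), and is convex along two consecutive edges labelled
-- by crossing intervals.  If u^m = 1 with m odd, the sum D(x) = Σ_{i<m} |x u^i| has the same two
-- properties, D(x u) = D(x), and, by parity, D changes along every edge.  Hence a path from x to
-- x u can be rearranged so that it first descends along a word N and then rises along P.  If N is
-- not trivial, replace x by N x, which lowers D; otherwise P must be trivial too, x = x u, u = 1.
--
-- Elements of order 2^k.  If x ∈ J_M has order m, then (s_{1,2M} x)² = x' x with x' the mirror
-- image of x in {M+1,…,2M}, which commutes with x; so s_{1,2M} x has order 2m.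
module Submission where

open import Defs
open import Data.Bool using (Bool; true)
open import Data.Bool.Properties using () renaming (_≟_ to _≟ᵇ_)
open import Data.Empty using (⊥-elim)
open import Data.Fin using (Fin; toℕ; fromℕ<)
open import Data.Fin.Properties using (all?; toℕ-fromℕ<)
open import Data.List using (List; []; _∷_; _++_; length; map)
open import Data.List.Properties using (++-assoc; ++-identityʳ; map-++)
open import Data.List.Relation.Unary.All as All using (All; []; _∷_)
open import Data.List.Relation.Unary.All.Properties using (++⁺)
open import Data.Nat using (ℕ; zero; suc; _+_; _*_; _∸_; _^_; _⊔_; _≤_; _<_; z≤n; s≤s)
open import Data.Nat.Induction using (<-wellFounded)
open import Data.Nat.Properties using (+-cancelʳ-<; +-cancelʳ-≡; +-cancelˡ-<; +-comm; +-identityʳ; +-mono-<; +-mono-≤; +-monoʳ-<; +-monoˡ-<; +-monoˡ-≤; +-suc; <-cmp; <-irrefl; <-≤-trans; <⇒≤; <⇒≱; _≟_; _≤?_; _<?_; even≢odd; m+[n∸m]≡n; m+n∸m≡n; m+n∸n≡m; m^n>0; m∸[m∸n]≡n; m∸n+n≡m; m≤m+n; m≤n+m; m≤m⊔n; m≤n⊔m; ⊔-lub; n≤1+n; suc-injective; ∸-monoʳ-<; ∸-monoʳ-≤; ≤-<-trans; ≤-antisym; ≤-refl; ≤-reflexive; ≤-trans; ≮⇒≥; ≰⇒>)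
open import Data.Nat.Tactic.RingSolver using (solve-∀)
open import Data.Product using (_×_; _,_; Σ; ∃; proj₁; proj₂)
open import Data.Sum using (_⊎_; inj₁; inj₂)
open import Data.Unit using (⊤; tt)
open import Data.Vec using (Vec; tabulate; lookup)
open import Data.Vec.Properties using (lookup∘tabulate; tabulate-cong) renaming (≡-dec to Vec-≡-dec)
open import Function using (mk⇔)
open import Induction.WellFounded using (Acc; acc)
open import Relation.Binary.Construct.Closure.Equivalence as EqC using ()
open import Relation.Binary.Definitions using (DecidableEquality; Decidable; Symmetric; tri<; tri≈; tri>)
open import Relation.Binary.PropositionalEquality using (_≡_; _≢_; refl; sym; trans; cong; cong₂; subst; subst₂; isEquivalence)
open import Relation.Binary.Structures using (IsEquivalence)
open import Relation.Nullary using (¬_; Dec; yes; no; does)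
open import Relation.Nullary.Decidable using (_×-dec_; _→-dec_; _⊎-dec_; ¬?; dec-true; does-⇔)

-- Right-angled Coxeter groups: reduced words and their length.

-- Reduced words, read with the last-multiplied generator at the head,
-- represent the elements of the right-angled Coxeter group on L.
module RightAngledCoxeter
  {L : Set} (_≟_ : DecidableEquality L)
  (C : L → L → Set) (C? : Decidable C) (C-sym : Symmetric C) where

  -- An occurrence of `a` commutes with every letter before it and so can be shuffled to the head;
  -- for reduced `w` this is a descent of the element.
  data Desc (a : L) : List L → Set where
    here  : ∀ {w} → Desc a (a ∷ w)
    there : ∀ {b w} → C a b → Desc a w → Desc a (b ∷ w)

  desc-tail : ∀ {a b w} → a ≢ b → Desc a (b ∷ w) → C a b × Desc a w
  desc-tail a≢b here = ⊥-elim (a≢b refl)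
  desc-tail a≢b (there c d) = c , d

  desc? : ∀ a w → Dec (Desc a w)
  desc? a [] = no λ ()
  desc? a (b ∷ w) with a ≟ b
  ... | yes refl = yes here
  ... | no a≢b with C? a b | desc? a w
  ...   | yes c | yes d = yes (there c d)
  ...   | yes _ | no ¬d = no λ e → let _ , d = desc-tail a≢b e in ¬d d
  ...   | no ¬c | _     = no λ e → let c , _ = desc-tail a≢b e in ¬c c

  infix 4 _~_
  data _~_ : List L → List L → Set where
    ~refl  : ∀ {w} → w ~ w
    ~cons  : ∀ {a w w'} → w ~ w' → a ∷ w ~ a ∷ w'
    ~swap  : ∀ {a b w} → C a b → a ∷ b ∷ w ~ b ∷ a ∷ w
    ~trans : ∀ {u v w} → u ~ v → v ~ w → u ~ w

  ~sym : ∀ {v w} → v ~ w → w ~ v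
  ~sym ~refl = ~refl
  ~sym (~cons e) = ~cons (~sym e)
  ~sym (~swap c) = ~swap (C-sym c)
  ~sym (~trans e f) = ~trans (~sym f) (~sym e)

  ~reflexive : ∀ {v w} → v ≡ w → v ~ w
  ~reflexive refl = ~refl

  ~length : ∀ {v w} → v ~ w → length v ≡ length w
  ~length ~refl = refl
  ~length (~cons e) = cong suc (~length e)
  ~length (~swap _) = refl
  ~length (~trans e f) = trans (~length e) (~length f)

  desc-resp : ∀ {a v w} → v ~ w → Desc a v → Desc a w
  desc-resp ~refl d = d
  desc-resp (~cons e) here = here
  desc-resp (~cons e) (there c d) = there c (desc-resp e d)
  desc-resp (~swap c) here = there c here
  desc-resp (~swap c) (there _ here) = here
  desc-resp (~swap c) (there c₁ (there c₂ d)) = there c₂ (there c₁ d)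
  desc-resp (~trans e f) d = desc-resp f (desc-resp e d)

  remove : L → List L → List L
  remove a [] = []
  remove a (b ∷ w) with a ≟ b
  ... | yes _ = w
  ... | no _  = b ∷ remove a w

  remove-head : ∀ a w → remove a (a ∷ w) ≡ w
  remove-head a w with a ≟ a
  ... | yes _ = refl
  ... | no a≢a = ⊥-elim (a≢a refl)

  remove-tail : ∀ {a b} w → a ≢ b → remove a (b ∷ w) ≡ b ∷ remove a w
  remove-tail {a} {b} w a≢b with a ≟ b
  ... | yes a≡b = ⊥-elim (a≢b a≡b)
  ... | no _ = refl

  remove-resp : ∀ {a v w} → v ~ w → remove a v ~ remove a w
  remove-resp ~refl = ~refl
  remove-resp {a} (~cons {b} e) with a ≟ b
  ... | yes _ = e
  ... | no _ = ~cons (remove-resp e)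
  remove-resp {a} (~swap {b} {c} {w} k) with a ≟ b | a ≟ c
  ... | yes refl | yes refl = ~refl
  ... | yes refl | no _ = ~reflexive (cong (c ∷_) (sym (remove-head a w)))
  ... | no _ | yes refl = ~reflexive (cong (b ∷_) (remove-head a w))
  ... | no a≢b | no a≢c =
    ~trans (~cons (~reflexive (remove-tail w a≢c)))
      (~trans (~swap k) (~cons (~reflexive (sym (remove-tail w a≢b)))))
  remove-resp (~trans e f) = ~trans (remove-resp e) (remove-resp f)

  remove-comm : ∀ a b w → remove a (remove b w) ≡ remove b (remove a w)
  remove-comm a b [] = refl
  remove-comm a b (c ∷ w) with a ≟ c | b ≟ c
  ... | yes refl | yes refl = refl
  ... | yes refl | no _ = remove-head a (remove b w)
  ... | no _ | yes refl = sym (remove-head b (remove a w))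
  ... | no a≢c | no b≢c =
    trans (remove-tail (remove b w) a≢c)
      (trans (cong (c ∷_) (remove-comm a b w)) (sym (remove-tail (remove a w) b≢c)))

  desc⇒~ : ∀ {a w} → Desc a w → w ~ a ∷ remove a w
  desc⇒~ {a} {b ∷ w} d with a ≟ b
  ... | yes refl = ~refl
  ... | no a≢b = let c , d' = desc-tail a≢b d in
    ~trans (~cons (desc⇒~ d')) (~swap (C-sym c))

  Reduced : List L → Set
  Reduced [] = ⊤
  Reduced (a ∷ w) = ¬ Desc a w × Reduced w

  reduced-resp : ∀ {v w} → v ~ w → Reduced v → Reduced w
  reduced-resp ~refl r = r
  reduced-resp (~cons e) (¬d , r) = (λ d → ¬d (desc-resp (~sym e) d)) , reduced-resp e r
  reduced-resp (~swap c) (¬d , ¬d' , r) =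
    (λ { here → ¬d here ; (there _ d) → ¬d' d }) , (λ d → ¬d (there c d)) , r
  reduced-resp (~trans e f) r = reduced-resp f (reduced-resp e r)

  -- Multiplication by a generator, on reduced words up to `~`. The defining relations of the group
  -- are `act-involutive` and `act-comm`.
  act : L → List L → List L
  act a w with desc? a w
  ... | yes _ = remove a w
  ... | no _  = a ∷ w

  act-desc : ∀ {a w} → Desc a w → act a w ≡ remove a w
  act-desc {a} {w} d with desc? a w
  ... | yes _ = refl
  ... | no ¬d = ⊥-elim (¬d d)

  act-asc : ∀ {a w} → ¬ Desc a w → act a w ≡ a ∷ w
  act-asc {a} {w} ¬d with desc? a w
  ... | yes d = ⊥-elim (¬d d)
  ... | no _ = refl

  act-resp : ∀ {a v w} → v ~ w → act a v ~ act a w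
  act-resp {a} {v} {w} e with desc? a v
  ... | yes d = ~trans (remove-resp e) (~reflexive (sym (act-desc (desc-resp e d))))
  ... | no ¬d = ~trans (~cons e)
    (~reflexive (sym (act-asc λ d → ¬d (desc-resp (~sym e) d))))

  act-reduced : ∀ {a w} → Reduced w → Reduced (act a w)
  act-reduced {a} {w} r with desc? a w
  ... | yes d = let _ , r' = reduced-resp (desc⇒~ d) r in r'
  ... | no ¬d = ¬d , r

  -- When `a` cancels, `a ∷ remove a w` is a reduced form of `w`, so `a` is no descent of the rest
  -- and is simply put back.
  act-involutive : ∀ {a w} → Reduced w → act a (act a w) ~ w
  act-involutive {a} {w} r with desc? a w
  ... | yes d = let ¬d , _ = reduced-resp (desc⇒~ d) r in
    ~trans (~reflexive (act-asc ¬d)) (~sym (desc⇒~ d))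
  ... | no ¬d = ~reflexive (trans (act-desc here) (remove-head a w))

  -- Whether `a` cancels or is prepended, `w` and `act a w` differ up to `~` by one `a` at the head,
  -- which `b` can pass. Hence `b` is a descent of both or of neither; the converse is `desc-act⁻`.
  desc-act⁺ : ∀ {a b w} → C b a → b ≢ a → Desc b w → Desc b (act a w)
  desc-act⁺ {a} {b} {w} c b≢a d with desc? a w
  ... | yes e = let _ , d' = desc-tail b≢a (desc-resp (desc⇒~ e) d) in d'
  ... | no _ = there c d

  desc-act⁻ : ∀ {a b w} → C b a → b ≢ a → Desc b (act a w) → Desc b w
  desc-act⁻ {a} {b} {w} c b≢a d with desc? a w
  ... | yes e = desc-resp (~sym (desc⇒~ e)) (there c d)
  ... | no _ = let _ , d' = desc-tail b≢a d in d'

  act-comm : ∀ {a b w} → C a b → act a (act b w) ~ act b (act a w)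
  act-comm {a} {b} {w} c with a ≟ b
  ... | yes refl = ~refl
  ... | no a≢b with desc? a w | desc? b w
  ...   | yes d | yes e = ~reflexive (trans
    (act-desc (subst (Desc a) (act-desc e) (desc-act⁺ c a≢b d)))
    (trans (remove-comm a b w)
      (sym (act-desc (subst (Desc b) (act-desc d)
        (desc-act⁺ (C-sym c) (λ p → a≢b (sym p)) e))))))
  ...   | yes d | no ¬e = ~reflexive (trans (act-desc (there c d))
    (trans (remove-tail w a≢b) (sym (act-asc λ e →
      ¬e (desc-act⁻ (C-sym c) (λ p → a≢b (sym p)) (subst (Desc b) (sym (act-desc d)) e))))))
  ...   | no ¬d | yes e = ~reflexive (trans
    (act-asc λ d → ¬d (desc-act⁻ c a≢b (subst (Desc a) (sym (act-desc e)) d)))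
    (sym (trans (act-desc (there (C-sym c) e)) (remove-tail w λ p → a≢b (sym p)))))
  ...   | no ¬d | no ¬e = ~trans
    (~reflexive (act-asc λ d → let _ , d' = desc-tail a≢b d in ¬d d'))
    (~trans (~swap c) (~reflexive (sym
      (act-asc λ e → let _ , e' = desc-tail (λ p → a≢b (sym p)) e in ¬e e'))))

  length-act-desc : ∀ {a w} → Desc a w → length w ≡ suc (length (act a w))
  length-act-desc d = trans (~length (desc⇒~ d)) (cong suc (cong length (sym (act-desc d))))

  length-act-asc : ∀ {a w} → ¬ Desc a w → length (act a w) ≡ suc (length w)
  length-act-asc ¬d = cong length (act-asc ¬d)

  length-act-odd : ∀ a w → ∃ λ k → length (act a w) + length w ≡ 1 + 2 * k
  length-act-odd a w with desc? a w
  ... | yes d = length (remove a w) , trans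
    (cong (length (remove a w) +_) (~length (desc⇒~ d))) (lem (length (remove a w)))
    where
    lem : ∀ x → x + suc x ≡ 1 + 2 * x
    lem = solve-∀
  ... | no ¬d = length w , lem (length w)
    where
    lem : ∀ x → suc x + x ≡ 1 + 2 * x
    lem = solve-∀

  -- By `desc-act⁺` and `desc-act⁻` the two edges labelled `b` both raise or both lower the length.
  parallelogram : ∀ {a b} w → C a b → a ≢ b →
    length (act b (act a w)) + length w ≡ length (act a w) + length (act b w)
  parallelogram {a} {b} w c a≢b with desc? b w
  ... | yes d = suc-injective (trans
    (cong (_+ length w) (sym (length-act-desc (desc-act⁺ (C-sym c) (λ p → a≢b (sym p)) d))))
    (trans (cong (length (act a w) +_) (trans (length-act-desc d) (cong (λ z → suc (length z)) (act-desc d)))) (+-suc _ _)))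
  ... | no ¬d = trans
    (cong (_+ length w) (length-act-asc λ e → ¬d (desc-act⁻ (C-sym c) (λ p → a≢b (sym p)) e)))
    (sym (+-suc _ _))

  length-≤-act : ∀ a w → length w ≤ suc (length (act a w))
  length-≤-act a w with desc? a w
  ... | yes d = ≤-reflexive (~length (desc⇒~ d))
  ... | no _ = ≤-trans (n≤1+n _) (n≤1+n _)

  -- If `a` shortens `w`, the next step loses at most one more. If `a` lengthens it, `a` stands at
  -- the head and blocks `b`, which then lengthens too.
  convex : ∀ {a b} w → ¬ C b a → b ≢ a →
    length (act a w) + length (act a w) ≤ length (act b (act a w)) + length w
  convex {a} {b} w ¬c b≢a = bound (desc? a w)
    where
    bound : Dec (Desc a w) →
      length (act a w) + length (act a w) ≤ length (act b (act a w)) + length w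
    bound (yes d) = subst (λ k → length (act a w) + length (act a w) ≤ length (act b (act a w)) + k)
      (sym (length-act-desc d))
      (subst (length (act a w) + length (act a w) ≤_) (sym (+-suc _ _))
        (+-monoˡ-≤ (length (act a w)) (length-≤-act b (act a w))))
    bound (no ¬d) = ≤-reflexive (trans
      (cong (length (act a w) +_) (length-act-asc ¬d))
      (trans (+-suc _ _) (cong (_+ length w) (sym (length-act-asc ¬e)))))
      where
      ¬e : ¬ Desc b (act a w)
      ¬e e = let c , _ = desc-tail b≢a (subst (Desc b) (act-asc ¬d) e) in ¬c c

-- Intervals, their reversals and reflected subintervals.

In : Letter → ℕ → Set
In (p , q) x = p ≤ x × x ≤ q

in? : ∀ s x → Dec (In s x)
in? (p , q) x = (p ≤? x) ×-dec (x ≤? q)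

Sub : Letter → Letter → Set
Sub (m , r) (p , q) = p ≤ m × r ≤ q

Apart : Letter → Letter → Set
Apart (p , q) (m , r) = q < m ⊎ r < p

sub-in : ∀ {s t x} → Sub t s → In t x → In s x
sub-in (p≤m , r≤q) (m≤x , x≤r) = ≤-trans p≤m m≤x , ≤-trans x≤r r≤q

apart-in : ∀ {s t x} → Apart s t → In s x → ¬ In t x
apart-in (inj₁ q<m) (_ , x≤q) (m≤x , _) = <⇒≱ q<m (≤-trans m≤x x≤q)
apart-in (inj₂ r<p) (p≤x , _) (_ , x≤r) = <⇒≱ r<p (≤-trans p≤x x≤r)

apart-sym : ∀ {s t} → Apart s t → Apart t s
apart-sym (inj₁ l) = inj₂ l
apart-sym (inj₂ l) = inj₁ l

σ : Letter → ℕ → ℕ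
σ s x with in? s x
... | yes _ = proj₁ s + proj₂ s ∸ x
... | no _  = x

σ-inside : ∀ {s x} → In s x → σ s x ≡ proj₁ s + proj₂ s ∸ x
σ-inside {s} {x} i with in? s x
... | yes _ = refl
... | no ¬i = ⊥-elim (¬i i)

σ-outside : ∀ {s x} → ¬ In s x → σ s x ≡ x
σ-outside {s} {x} ¬i with in? s x
... | yes i = ⊥-elim (¬i i)
... | no _ = refl

-- For `[m,r]` inside `[p,q]`, this is the image of `[m,r]` under the reversal of `[p,q]`, the new
-- interval in `j3`.
reflect : Letter → Letter → Letter
reflect (p , q) (m , r) = p + q ∸ r , p + q ∸ m

σ-in : ∀ {s x} → In s x → In s (σ s x)
σ-in {p , q} {x} i@(p≤x , x≤q) = subst (In (p , q)) (sym (σ-inside i))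
  ( subst (_≤ p + q ∸ x) (m+n∸n≡m p q) (∸-monoʳ-≤ (p + q) x≤q)
  , subst (p + q ∸ x ≤_) (m+n∸m≡n p q) (∸-monoʳ-≤ (p + q) p≤x))

in⇒≤+ : ∀ {p q x} → In (p , q) x → x ≤ p + q
in⇒≤+ {p} {q} (_ , x≤q) = ≤-trans x≤q (m≤n+m q p)

σ-involutive : ∀ s x → σ s (σ s x) ≡ x
σ-involutive s x with in? s x
... | yes i = trans (σ-inside (subst (In s) (σ-inside i) (σ-in i))) (m∸[m∸n]≡n (in⇒≤+ i))
... | no ¬i = σ-outside ¬i

-- A relation instead of a function: the preimage under `σ s` of an interval crossing `s` need not
-- be an interval.
Pull : Letter → Letter → Letter → Set
Pull s t t' = ∀ x → (In t (σ s x) → In t' x) × (In t' x → In t (σ s x))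

pull : ∀ {s t t'} → (∀ x → In t x → In t' (σ s x)) → (∀ x → In t' x → In t (σ s x)) → Pull s t t'
pull {s} {t' = t'} f g x = (λ i → subst (In t') (σ-involutive s x) (f (σ s x) i)) , g x

pull-self : ∀ s → Pull s s s
pull-self s = pull {s} {s} (λ _ → σ-in) (λ _ → σ-in)

in-σ-fixed : ∀ {s t} → Sub s t ⊎ Apart s t → ∀ x → In t x → In t (σ s x)
in-σ-fixed {s} {t} c x i with in? s x
in-σ-fixed {s} {t} (inj₁ s⊆t) x i | yes j = sub-in s⊆t (subst (In s) (σ-inside j) (σ-in j))
in-σ-fixed (inj₂ a) x i | yes j = ⊥-elim (apart-in a j i)
... | no _ = i

pull-fixed : ∀ {s t} → Sub s t ⊎ Apart s t → Pull s t t
pull-fixed {s} {t} c = pull {s} {t} (in-σ-fixed c) (in-σ-fixed c)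

reflect-sub : ∀ {s t} → Sub t s → Sub (reflect s t) s
reflect-sub {p , q} {m , r} (p≤m , r≤q) =
  subst (_≤ p + q ∸ r) (m+n∸n≡m p q) (∸-monoʳ-≤ (p + q) r≤q) ,
  subst (p + q ∸ m ≤_) (m+n∸m≡n p q) (∸-monoʳ-≤ (p + q) p≤m)

reflect-involutive : ∀ {p q m r} → m ≤ r → r ≤ q → reflect (p , q) (reflect (p , q) (m , r)) ≡ (m , r)
reflect-involutive {p} {q} m≤r r≤q = let r≤ = ≤-trans r≤q (m≤n+m q p) in
  cong₂ _,_ (m∸[m∸n]≡n (≤-trans m≤r r≤)) (m∸[m∸n]≡n r≤)

reflect-valid : ∀ {n p q m r} → Valid n (p , q) → p ≤ m → m < r → r ≤ q → Valid n (reflect (p , q) (m , r))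
reflect-valid {n} {p} {q} (1≤p , _ , q≤n) p≤m m<r r≤q = let a , b = reflect-sub {p , q} (p≤m , r≤q) in
  ≤-trans 1≤p a , ∸-monoʳ-< m<r (≤-trans r≤q (m≤n+m q p)) , ≤-trans b q≤n

in-reflect : ∀ {s t} → Sub t s → ∀ x → In t x → In (reflect s t) (σ s x)
in-reflect {p , q} {t} t⊆s x i@(m≤x , x≤r) = subst (In (reflect (p , q) t)) (sym (σ-inside (sub-in t⊆s i)))
  (∸-monoʳ-≤ (p + q) x≤r , ∸-monoʳ-≤ (p + q) m≤x)

pull-inner : ∀ {p q m r} → p ≤ m → m ≤ r → r ≤ q → Pull (p , q) (m , r) (reflect (p , q) (m , r))
pull-inner {p} {q} {m} {r} p≤m m≤r r≤q =
  pull {p , q} {m , r} (in-reflect (p≤m , r≤q))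
    (λ x i → subst (λ t → In t (σ (p , q) x)) (reflect-involutive {p} m≤r r≤q)
      (in-reflect (reflect-sub {p , q} {m , r} (p≤m , r≤q)) x i))

pull-reflect : ∀ {p q m r} → p ≤ m → m ≤ r → r ≤ q → Pull (p , q) (reflect (p , q) (m , r)) (m , r)
pull-reflect {p} {q} {m} {r} p≤m m≤r r≤q =
  pull {p , q} {reflect (p , q) (m , r)}
    (λ x i → subst (λ t → In t (σ (p , q) x)) (reflect-involutive {p} m≤r r≤q)
      (in-reflect (reflect-sub {p , q} {m , r} (p≤m , r≤q)) x i))
    (in-reflect (p≤m , r≤q))

σ-commute : ∀ {s t} → Apart s t → ∀ x → σ s (σ t x) ≡ σ t (σ s x)
σ-commute {s} {t} a x with in? s x | in? t x
... | yes i | yes j = ⊥-elim (apart-in a i j)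
... | yes i | no _ = trans (σ-inside i)
  (sym (σ-outside (apart-in a (subst (In s) (σ-inside i) (σ-in i)))))
... | no _ | yes j = trans
  (σ-outside (apart-in (apart-sym {s} {t} a) (subst (In t) (σ-inside j) (σ-in j))))
  (sym (σ-inside j))
... | no ¬i | no ¬j = trans (σ-outside ¬i) (sym (σ-outside ¬j))

-- Adding `m + r`, which is `x + y`, turns both sides into `c + c`; the bounds keep the truncated
-- differences exact.
complement-sum : ∀ {c m r x y} → m ≤ c → r ≤ c → x ≤ c → y ≤ c → m + r ≡ x + y →
  (c ∸ r) + (c ∸ m) ≡ (c ∸ x) + (c ∸ y)
complement-sum {c} {m} {r} {x} {y} m≤c r≤c x≤c y≤c e = +-cancelʳ-≡ (m + r) _ _
  (trans (shuffle₁ (c ∸ r) (c ∸ m) m r)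
    (trans (cong₂ _+_ (m∸n+n≡m r≤c) (m∸n+n≡m m≤c))
      (sym (trans (cong ((c ∸ x) + (c ∸ y) +_) e)
        (trans (shuffle₂ (c ∸ x) (c ∸ y) x y) (cong₂ _+_ (m∸n+n≡m x≤c) (m∸n+n≡m y≤c)))))))
  where
  shuffle₁ : ∀ a b c d → a + b + (c + d) ≡ (a + d) + (b + c)
  shuffle₁ = solve-∀
  shuffle₂ : ∀ a b c d → a + b + (c + d) ≡ (a + c) + (b + d)
  shuffle₂ = solve-∀

-- Points outside `t` go to points outside the reflected interval. For `x` in `t`, the endpoints of
-- the reflected interval add up to `σ s x + σ s (σ t x)` by `complement-sum`, so its reversal
-- exchanges these two points.
σ-conjugate : ∀ {p q m r} → p ≤ m → m ≤ r → r ≤ q → ∀ x →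
  σ (p , q) (σ (m , r) x) ≡ σ (reflect (p , q) (m , r)) (σ (p , q) x)
σ-conjugate {p} {q} {m} {r} p≤m m≤r r≤q x = split (in? (m , r) x)
  where
  s t : Letter
  s = p , q
  t = m , r
  t⊆s : Sub t s
  t⊆s = p≤m , r≤q
  split : Dec (In t x) → σ s (σ t x) ≡ σ (reflect s t) (σ s x)
  split (no ¬i) = trans (cong (σ s) (σ-outside ¬i))
    (sym (σ-outside λ j → ¬i (proj₁ (pull-reflect p≤m m≤r r≤q x) j)))
  split (yes i) = trans (σ-inside y∈s) (sym (trans (σ-inside (in-reflect t⊆s x i))
    (trans (cong₂ _∸_ (complement-sum (≤-trans m≤r r≤c) r≤c x≤c (in⇒≤+ y∈s) sum) (σ-inside x∈s))
      (m+n∸m≡n (p + q ∸ x) _))))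
    where
    x∈s : In s x
    x∈s = sub-in t⊆s i
    y∈s : In s (σ t x)
    y∈s = sub-in t⊆s (σ-in i)
    x≤c : x ≤ p + q
    x≤c = in⇒≤+ x∈s
    r≤c : r ≤ p + q
    r≤c = ≤-trans r≤q (m≤n+m q p)
    sum : m + r ≡ x + σ t x
    sum = trans (sym (m+[n∸m]≡n (in⇒≤+ i))) (cong (x +_) (sym (σ-inside i)))

-- The permutation of a word, and calculus with the congruence.

π : List Letter → ℕ → ℕ
π [] i = i
π (s ∷ x) i = σ s (π x i)

π-++ : ∀ x y i → π (x ++ y) i ≡ π x (π y i)
π-++ [] y i = refl
π-++ (s ∷ x) y i = cong (σ s) (π-++ x y i)

π-rel : ∀ {n l r} v → Rel₀ n l r → ∀ i → π (l ++ v) i ≡ π (r ++ v) i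
π-rel v (j1 {p} {q} _) i = σ-involutive (p , q) (π v i)
π-rel v (j2 {p} {q} {m} {r} _ _ a) i = σ-commute {p , q} {m , r} a (π v i)
π-rel v (j3 _ (_ , m<r , _) p≤m r≤q) i = σ-conjugate p≤m (<⇒≤ m<r) r≤q (π v i)

module Congruence (n : ℕ) where

  ≈-refl : ∀ {x} → x ≈[ n ] x
  ≈-refl = IsEquivalence.refl (EqC.isEquivalence (Step n))

  ≈-sym : ∀ {x y} → x ≈[ n ] y → y ≈[ n ] x
  ≈-sym = IsEquivalence.sym (EqC.isEquivalence (Step n))

  ≈-trans : ∀ {x y z} → x ≈[ n ] y → y ≈[ n ] z → x ≈[ n ] z
  ≈-trans = IsEquivalence.trans (EqC.isEquivalence (Step n))

  ≈-reflexive : ∀ {x y} → x ≡ y → x ≈[ n ] y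
  ≈-reflexive refl = ≈-refl

  ≈-rel : ∀ {l r} v → Rel₀ n l r → (l ++ v) ≈[ n ] (r ++ v)
  ≈-rel v ρ = EqC.return (ctx [] v ρ)

  ≈-cons : ∀ s {x y} → x ≈[ n ] y → (s ∷ x) ≈[ n ] (s ∷ y)
  ≈-cons s = EqC.gmap (s ∷_) λ { (ctx u v ρ) → ctx (s ∷ u) v ρ }

  ≈-++ˡ : ∀ u {x y} → x ≈[ n ] y → (u ++ x) ≈[ n ] (u ++ y)
  ≈-++ˡ [] e = e
  ≈-++ˡ (s ∷ u) e = ≈-cons s (≈-++ˡ u e)

  ≈-++ʳ : ∀ v {x y} → x ≈[ n ] y → (x ++ v) ≈[ n ] (y ++ v)
  ≈-++ʳ v = EqC.gmap (_++ v) λ { (ctx u z {l} {r} ρ) →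
    subst₂ (Step n) (sym (assoc u l z)) (sym (assoc u r z)) (ctx u (z ++ v) ρ) }
    where
    assoc : ∀ (u l z : List Letter) → (u ++ l ++ z) ++ v ≡ u ++ l ++ z ++ v
    assoc u l z = trans (++-assoc u (l ++ z) v) (cong (u ++_) (++-assoc l z v))

  ≈-++ : ∀ {x x' y y'} → x ≈[ n ] x' → y ≈[ n ] y' → (x ++ y) ≈[ n ] (x' ++ y')
  ≈-++ {x' = x'} {y} e f = ≈-trans (≈-++ʳ y e) (≈-++ˡ x' f)

  ≈-cancelˡ : ∀ {x y z} → Word n x → (x ++ y) ≈[ n ] (x ++ z) → y ≈[ n ] z
  ≈-cancelˡ [] e = e
  ≈-cancelˡ (_∷_ {s} v vs) e = ≈-cancelˡ vs
    (≈-trans (≈-sym (≈-rel _ (j1 v))) (≈-trans (≈-cons s e) (≈-rel _ (j1 v))))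

  π-resp : ∀ {x y} → x ≈[ n ] y → ∀ i → π x i ≡ π y i
  π-resp e i = EqC.gfold isEquivalence (λ x → π x i)
    (λ { (ctx u v {l} {r} ρ) → trans (π-++ u (l ++ v) i)
      (trans (cong (π u) (π-rel v ρ i)) (sym (π-++ u (r ++ v) i))) }) e

-- Subsets as bit vectors; nested or disjoint ones commute.

_⊑_ : ∀ {N} → Vec Bool N → Vec Bool N → Set
A ⊑ B = ∀ i → lookup A i ≡ true → lookup B i ≡ true

Disjoint : ∀ {N} → Vec Bool N → Vec Bool N → Set
Disjoint A B = ∀ i → lookup A i ≡ true → lookup B i ≢ true

data Compat {N : ℕ} (A B : Vec Bool N) : Set where
  below    : A ⊑ B → Compat A B
  above    : B ⊑ A → Compat A B
  disjoint : Disjoint A B → Compat A B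

_⊑?_ : ∀ {N} → Decidable (_⊑_ {N})
A ⊑? B = all? λ i → (lookup A i ≟ᵇ true) →-dec (lookup B i ≟ᵇ true)

disjoint? : ∀ {N} → Decidable (Disjoint {N})
disjoint? A B = all? λ i → (lookup A i ≟ᵇ true) →-dec ¬? (lookup B i ≟ᵇ true)

compat? : ∀ {N} → Decidable (Compat {N})
compat? A B with A ⊑? B | B ⊑? A | disjoint? A B
... | yes f | _     | _     = yes (below f)
... | no _  | yes f | _     = yes (above f)
... | no _  | no _  | yes f = yes (disjoint f)
... | no f  | no g  | no h  = no λ { (below c) → f c ; (above c) → g c ; (disjoint c) → h c }

compat-refl : ∀ {N} (A : Vec Bool N) → Compat A A
compat-refl A = below λ _ a → a

compat-sym : ∀ {N} → Symmetric (Compat {N})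
compat-sym (below f) = above f
compat-sym (above f) = below f
compat-sym (disjoint f) = disjoint λ i b a → f i a b

does-sound : ∀ {P : Set} (P? : Dec P) → does P? ≡ true → P
does-sound (yes p) _ = p

Nested-or-apart : Letter → Letter → Set
Nested-or-apart s t = Sub s t ⊎ Sub t s ⊎ Apart s t

-- Coxeter generators attached to the edges of the Cayley graph.

-- J_n maps to W ⋊ S_n by s_{p,q} ↦ ([p,q], reversal of [p,q]), where W is the right-angled
-- Coxeter group on the subsets of {0,…,n}, two subsets commuting when nested or disjoint.
-- `coxeter x` is the W-component of x⁻¹, and `img x t` the preimage of [t] under `π x`.
module Length (n : ℕ) where

  open Congruence n
  open RightAngledCoxeter {Vec Bool (suc n)} (Vec-≡-dec _≟ᵇ_) Compat compat? compat-sym public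

  img : List Letter → Letter → Vec Bool (suc n)
  img x t = tabulate λ i → does (in? t (π x (toℕ i)))

  img-cong : ∀ {x y s t} →
    (∀ i → (In s (π x i) → In t (π y i)) × (In t (π y i) → In s (π x i))) → img x s ≡ img y t
  img-cong {x} {y} {s} {t} f = tabulate-cong λ i →
    does-⇔ (mk⇔ (proj₁ (f (toℕ i))) (proj₂ (f (toℕ i))))
      (in? s (π x (toℕ i))) (in? t (π y (toℕ i)))

  -- Opposite edges of a square, `t` at `s ∷ x` and `t'` at `x`, get the same Coxeter generator by
  -- this.
  img-pull : ∀ s t t' x → Pull s t t' → img (s ∷ x) t ≡ img x t'
  img-pull s t t' x f = img-cong {s ∷ x} {x} {t} {t'} λ i → f (π x i)

  img⁻ : ∀ x t i → lookup (img x t) i ≡ true → In t (π x (toℕ i))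
  img⁻ x t i e = does-sound (in? t _) (trans (sym (lookup∘tabulate (λ i → does (in? t (π x (toℕ i)))) i)) e)

  img⁺ : ∀ x t i → In t (π x (toℕ i)) → lookup (img x t) i ≡ true
  img⁺ x t i e = trans (lookup∘tabulate (λ i → does (in? t (π x (toℕ i)))) i) (dec-true (in? t _) e)

  img-compat : ∀ x {s t} → Nested-or-apart s t → Compat (img x s) (img x t)
  img-compat x {s} {t} (inj₁ c) = below λ i e → img⁺ x t i (sub-in c (img⁻ x s i e))
  img-compat x {s} {t} (inj₂ (inj₁ c)) = above λ i e → img⁺ x s i (sub-in c (img⁻ x t i e))
  img-compat x {s} {t} (inj₂ (inj₂ c)) =
    disjoint λ i e f → apart-in c (img⁻ x s i e) (img⁻ x t i f)

  σ-bound : ∀ {s y} → Valid n s → y ≤ n → σ s y ≤ n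
  σ-bound {s} {y} (_ , _ , q≤n) y≤n with in? s y
  ... | yes i = ≤-trans (proj₂ (subst (In s) (σ-inside i) (σ-in i))) q≤n
  ... | no _ = y≤n

  π-surjective : ∀ {x y} → Word n x → y ≤ n → ∃ λ (i : Fin (suc n)) → π x (toℕ i) ≡ y
  π-surjective {y = y} [] y≤n = fromℕ< (s≤s y≤n) , toℕ-fromℕ< (s≤s y≤n)
  π-surjective {y = y} (_∷_ {s} v vs) y≤n = let i , e = π-surjective vs (σ-bound v y≤n) in
    i , trans (cong (σ s) e) (σ-involutive s y)

  -- Every point up to `n` is a value of `π x`, so the inclusion can be tested at the two endpoints
  -- of `s`.
  img-⊑⁻ : ∀ {x s t} → Word n x → Valid n s → img x s ⊑ img x t → Sub s t
  img-⊑⁻ {x} {p , q} {m , r} vx (_ , p<q , q≤n) f =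
    proj₁ (elem p (≤-trans (<⇒≤ p<q) q≤n) (≤-refl , <⇒≤ p<q)) ,
    proj₂ (elem q q≤n (<⇒≤ p<q , ≤-refl))
    where
    elem : ∀ y → y ≤ n → In (p , q) y → In (m , r) y
    elem y y≤n y∈s = let i , e = π-surjective vx y≤n in
      subst (In (m , r)) e (img⁻ x (m , r) i (f i (img⁺ x (p , q) i (subst (In (p , q)) (sym e) y∈s))))

  -- Intervals that are not apart share the larger of their left endpoints, and its preimage under
  -- `π x` lies in both subsets.
  img-disjoint⁻ : ∀ {x s t} → Word n x → Valid n s → Valid n t → Disjoint (img x s) (img x t) → Apart s t
  img-disjoint⁻ {x} {p , q} {m , r} vx (_ , p<q , q≤n) (_ , m<r , r≤n) f with q <? m | r <? p
  ... | yes l | _ = inj₁ l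
  ... | no _ | yes l = inj₂ l
  ... | no q≮m | no r≮p = ⊥-elim (f i
      (img⁺ x (p , q) i (subst (In (p , q)) (sym e) (m≤m⊔n p m , p⊔m≤q)))
      (img⁺ x (m , r) i (subst (In (m , r)) (sym e) (m≤n⊔m p m , ⊔-lub (≮⇒≥ r≮p) (<⇒≤ m<r)))))
    where
    p⊔m≤q : p ⊔ m ≤ q
    p⊔m≤q = ⊔-lub (<⇒≤ p<q) (≮⇒≥ q≮m)
    i : Fin (suc n)
    i = proj₁ (π-surjective vx (≤-trans p⊔m≤q q≤n))
    e : π x (toℕ i) ≡ p ⊔ m
    e = proj₂ (π-surjective vx (≤-trans p⊔m≤q q≤n))

  img-compat⁻ : ∀ {x s t} → Word n x → Valid n s → Valid n t → Compat (img x s) (img x t) → Nested-or-apart s t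
  img-compat⁻ vx vs vt (below f) = inj₁ (img-⊑⁻ vx vs f)
  img-compat⁻ vx vs vt (above f) = inj₂ (inj₁ (img-⊑⁻ vx vt f))
  img-compat⁻ vx vs vt (disjoint f) = inj₂ (inj₂ (img-disjoint⁻ vx vs vt f))

  img-injective : ∀ {x s t} → Word n x → Valid n s → Valid n t → img x s ≡ img x t → s ≡ t
  img-injective {x} vx vs vt e =
    let a , b = img-⊑⁻ vx vs (λ i f → subst (λ A → lookup A i ≡ true) e f)
        c , d = img-⊑⁻ vx vt (λ i f → subst (λ A → lookup A i ≡ true) (sym e) f)
    in cong₂ _,_ (≤-antisym c a) (≤-antisym b d)

  -- Invariance of the Coxeter component under the cactus relations.

  coxeter : List Letter → List (Vec Bool (suc n))
  coxeter [] = []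
  coxeter (s ∷ x) = act (img x s) (coxeter x)

  coxeter-reduced : ∀ x → Reduced (coxeter x)
  coxeter-reduced [] = tt
  coxeter-reduced (s ∷ x) = act-reduced (coxeter-reduced x)

  -- In `j2` and `j3` alike, both sides act by the commuting generators `img v s` and `img v t`, in
  -- opposite orders. In `j1` the same generator acts twice, because `σ s` preserves `s`.
  coxeter-rel : ∀ {l r} v → Rel₀ n l r → coxeter (l ++ v) ~ coxeter (r ++ v)
  coxeter-rel v (j1 {p} {q} _) = ~trans
    (~reflexive (cong (λ a → act a (coxeter ((p , q) ∷ v))) (img-pull (p , q) (p , q) (p , q) v (pull-self (p , q)))))
    (act-involutive (coxeter-reduced v))
  coxeter-rel v (j2 {p} {q} {m} {r} _ _ a) = ~trans
    (~reflexive (cong (λ b → act b (coxeter (t ∷ v))) (img-pull t s s v (pull-fixed (inj₂ (apart-sym {s} {t} a))))))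
    (~trans (act-comm {w = coxeter v} (img-compat v {s} {t} (inj₂ (inj₂ a))))
      (~reflexive (cong (λ b → act b (coxeter (s ∷ v))) (sym (img-pull s t t v (pull-fixed {s} {t} (inj₂ a)))))))
    where
    s t : Letter
    s = p , q
    t = m , r
  coxeter-rel v (j3 {p} {q} {m} {r} _ (_ , m<r , _) p≤m r≤q) = ~trans
    (~reflexive (cong (λ b → act b (coxeter (t ∷ v))) (img-pull t s s v (pull-fixed {t} {s} (inj₁ (p≤m , r≤q))))))
    (~trans (act-comm {w = coxeter v} (img-compat v {s} {t} (inj₂ (inj₁ (p≤m , r≤q)))))
      (~reflexive (cong (λ b → act b (coxeter (s ∷ v))) (sym (img-pull s (reflect s t) t v (pull-reflect p≤m (<⇒≤ m<r) r≤q))))))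
    where
    s t : Letter
    s = p , q
    t = m , r

  img-resp : ∀ x y t → (∀ i → π x i ≡ π y i) → img x t ≡ img y t
  img-resp x y t e = tabulate-cong λ i → cong (λ k → does (in? t k)) (e (toℕ i))

  -- The generators contributed by `u` depend on what follows only through its permutation.
  coxeter-++ : ∀ u {x y} → (∀ i → π x i ≡ π y i) → coxeter x ~ coxeter y → coxeter (u ++ x) ~ coxeter (u ++ y)
  coxeter-++ [] e f = f
  coxeter-++ (s ∷ u) {x} {y} e f = ~trans (act-resp (coxeter-++ u e f))
    (~reflexive (cong (λ a → act a (coxeter (u ++ y))) (img-resp (u ++ x) (u ++ y) s λ i →
      trans (π-++ u x i) (trans (cong (π u) (e i)) (sym (π-++ u y i))))))

  -- Length and the local shape of the Cayley graph.

  len : List Letter → ℕ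
  len x = length (coxeter x)

  len-resp : ∀ {x y} → x ≈[ n ] y → len x ≡ len y
  len-resp = EqC.gfold isEquivalence len λ { (ctx u v ρ) → ~length (coxeter-++ u (π-rel v ρ) (coxeter-rel v ρ)) }

  len-odd : ∀ s x → ∃ λ k → len (s ∷ x) + len x ≡ 1 + 2 * k
  len-odd s x = length-act-odd (img x s) (coxeter x)

  -- By `img-pull` the edge `t` at `s ∷ x` carries the generator of `t'` at `x`; injectivity of
  -- `img x` makes it differ from that of `s`.
  len-square : ∀ {s t t' x} → Word n x → Valid n s → Valid n t' → Pull s t t' →
    Nested-or-apart s t' → s ≢ t' → len (t ∷ s ∷ x) + len x ≡ len (s ∷ x) + len (t' ∷ x)
  len-square {s} {t} {t'} {x} vx vs vt' f c s≢t' = trans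
    (cong (λ b → length (act b (coxeter (s ∷ x))) + len x) (img-pull s t t' x f))
    (parallelogram (coxeter x) (img-compat x c) λ e → s≢t' (img-injective vx vs vt' e))

  -- The edge `s` carries the same generator seen from `x` and from `s ∷ x`, and at `s ∷ x` crossing
  -- intervals have incompatible preimages.
  len-convex : ∀ {s t x} → Word n x → Valid n s → Valid n t → ¬ Nested-or-apart s t →
    len (s ∷ x) + len (s ∷ x) ≤ len (t ∷ s ∷ x) + len x
  len-convex {s} {t} {x} vx vs vt ¬c = convex (coxeter x) ¬compat
    (λ e → ¬compat (subst (λ a → Compat a (img x s)) (sym e) (compat-refl (img x s))))
    where
    ¬compat : ¬ Compat (img (s ∷ x) t) (img x s)
    ¬compat c = ¬c (img-compat⁻ {s ∷ x} (vs ∷ vx) vs vt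
      (compat-sym (subst (Compat (img (s ∷ x) t)) (sym (img-pull s s s x (pull-self s))) c)))

  -- The shapes of a path `x`, `s x`, `t s x`: it backtracks, it is half of a square with fourth
  -- corner `t' x`, or its labels cross.
  data Corner (s t : Letter) : Set where
    same     : s ≡ t → Corner s t
    square   : ∀ s' t' → Valid n s' → Valid n t' →
      (∀ x → (t ∷ s ∷ x) ≈[ n ] (s' ∷ t' ∷ x)) →
      Pull s t t' → Nested-or-apart s t' → s ≢ t' → Corner s t
    crossing : ¬ Nested-or-apart s t → Corner s t

  corner : ∀ {s t} → Valid n s → Valid n t → Corner s t
  corner {p , q} {m , r} vs@(_ , p<q , _) vt@(_ , m<r , _) with (m ≤? p) ×-dec (q ≤? r)
  ... | yes (m≤p , q≤r) = inside
    where
    inside : Corner (p , q) (m , r)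
    inside with (p ≟ m) ×-dec (q ≟ r)
    ... | yes (refl , refl) = same refl
    ... | no s≢t = square (reflect (m , r) (p , q)) (m , r) (reflect-valid vt m≤p p<q q≤r) vt
      (λ x → ≈-rel x (j3 vt vs m≤p q≤r)) (pull-fixed (inj₁ (m≤p , q≤r))) (inj₁ (m≤p , q≤r))
      λ { refl → s≢t (refl , refl) }
  ... | no s⊈t with (p ≤? m) ×-dec (r ≤? q)
  -- `j3` read from right to left, with `reflect s t` as the inner interval; reflecting twice gives
  -- `t` back.
  ...   | yes (p≤m , r≤q) = square (p , q) (reflect (p , q) (m , r)) vs vt'
      (λ x → ≈-sym (subst (λ t → ((p , q) ∷ reflect (p , q) (m , r) ∷ x) ≈[ n ] (t ∷ (p , q) ∷ x))
        back (≈-rel x (j3 vs vt' (proj₁ sub) (proj₂ sub)))))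
      (pull-inner p≤m (<⇒≤ m<r) r≤q) (inj₂ (inj₁ sub))
      -- If `s` equalled the reflection of `t`, reflecting both in `s` would give `s = t`.
      λ e → s⊈t (subst (Sub (p , q)) (trans (trans (sym (reflect-self p q)) (cong (reflect (p , q)) e)) back) (≤-refl , ≤-refl))
    where
    vt' : Valid n (reflect (p , q) (m , r))
    vt' = reflect-valid vs p≤m m<r r≤q
    sub : Sub (reflect (p , q) (m , r)) (p , q)
    sub = reflect-sub {p , q} {m , r} (p≤m , r≤q)
    back : reflect (p , q) (reflect (p , q) (m , r)) ≡ (m , r)
    back = reflect-involutive {p} (<⇒≤ m<r) r≤q
    reflect-self : ∀ p q → reflect (p , q) (p , q) ≡ (p , q)
    reflect-self p q = cong₂ _,_ (m+n∸n≡m p q) (m+n∸m≡n p q)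
  ...   | no t⊈s with (q <? m) ⊎-dec (r <? p)
  ...     | yes a = square (p , q) (m , r) vs vt (λ x → ≈-sym (≈-rel x (j2 vs vt a)))
      (pull-fixed (inj₂ a)) (inj₂ (inj₂ a)) λ { refl → s⊈t (≤-refl , ≤-refl) }
  ...     | no ¬a = crossing λ { (inj₁ c) → s⊈t c ; (inj₂ (inj₁ c)) → t⊈s c ; (inj₂ (inj₂ c)) → ¬a c }

-- Finite sums: shift, comparison and parity.

∑ : ℕ → (ℕ → ℕ) → ℕ
∑ zero f = 0
∑ (suc m) f = f 0 + ∑ m (λ i → f (suc i))

∑-cong : ∀ m {f g : ℕ → ℕ} → (∀ i → f i ≡ g i) → ∑ m f ≡ ∑ m g
∑-cong zero e = refl
∑-cong (suc m) e = cong₂ _+_ (e 0) (∑-cong m λ i → e (suc i))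

∑-shift : ∀ m (f : ℕ → ℕ) → ∑ m (λ i → f (suc i)) + f 0 ≡ ∑ m f + f m
∑-shift zero f = refl
∑-shift (suc m) f = trans (cong (_+ f 0) (+-comm (f 1) _))
  (trans (cong (_+ f 0) (∑-shift m (λ i → f (suc i)))) (rotate _ (f (suc m)) (f 0)))
  where
  rotate : ∀ a b c → a + b + c ≡ c + a + b
  rotate = solve-∀

interchange : ∀ a b c d → a + b + (c + d) ≡ a + c + (b + d)
interchange = solve-∀

∑-mono₂ : ∀ m (f g h k : ℕ → ℕ) → (∀ i → f i + g i ≤ h i + k i) → ∑ m f + ∑ m g ≤ ∑ m h + ∑ m k
∑-mono₂ zero f g h k e = ≤-refl
∑-mono₂ (suc m) f g h k e = subst₂ _≤_ (interchange (f 0) (g 0) _ _) (interchange (h 0) (k 0) _ _)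
  (+-mono-≤ (e 0) (∑-mono₂ m _ _ _ _ λ i → e (suc i)))

∑-odd : ∀ m (f g : ℕ → ℕ) → (∀ i → ∃ λ k → f i + g i ≡ 1 + 2 * k) → ∃ λ k → ∑ m f + ∑ m g ≡ m + 2 * k
∑-odd zero f g e = 0 , refl
∑-odd (suc m) f g e = let a , p = e 0 ; b , q = ∑-odd m _ _ λ i → e (suc i) in
  a + b , trans (interchange (f 0) _ (g 0) _) (trans (cong₂ _+_ p q) (regroup a b m))
  where
  regroup : ∀ a b m → 1 + 2 * a + (m + 2 * b) ≡ suc m + 2 * (a + b)
  regroup = solve-∀

^w-all : ∀ {P : Letter → Set} {x} → All P x → ∀ i → All P (x ^w i)
^w-all a zero = []
^w-all a (suc i) = ++⁺ a (^w-all a i)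

-- Triviality of elements of odd order.

module OddOrder (n : ℕ) {u : List Letter} (vu : Word n u) (j : ℕ)
  (torsion : (u ^w (1 + 2 * j)) ≈[ n ] []) where

  open Congruence n
  open Length n using (len; len-resp; len-odd; len-square; len-convex; same; square; crossing; corner)

  m : ℕ
  m = 1 + 2 * j

  dist : List Letter → ℕ → ℕ
  dist x i = len (x ++ u ^w i)

  D : List Letter → ℕ
  D x = ∑ m (dist x)

  D-resp : ∀ {x y} → x ≈[ n ] y → D x ≡ D y
  D-resp e = ∑-cong m λ i → len-resp (≈-++ʳ (u ^w i) e)

  -- Right multiplication by `u` shifts the summands by one index, and the term entering at the end
  -- equals the one lost at the start because `u ^w m` is trivial.
  D-period : ∀ x → D (x ++ u) ≡ D x
  D-period x = +-cancelʳ-≡ (len (x ++ [])) _ _ (trans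
    (cong (_+ len (x ++ [])) (∑-cong m λ i → cong len (++-assoc x u (u ^w i))))
    (trans (∑-shift m (dist x))
      (cong (D x +_) (len-resp (≈-++ˡ x torsion)))))

  -- Each of the m distances changes by ±1 along an edge, and m is odd.
  D-step : ∀ s x → D (s ∷ x) ≢ D x
  D-step s x e = let k , p = ∑-odd m (dist (s ∷ x)) (dist x) λ i → len-odd s (x ++ u ^w i) in
    even≢odd (D x) (j + k) (trans (double (D x)) (trans (cong (_+ D x) (sym e)) (trans p (halve j k))))
    where
    double : ∀ a → 2 * a ≡ a + a
    double = solve-∀
    halve : ∀ j k → 1 + 2 * j + 2 * k ≡ suc (2 * (j + k))
    halve = solve-∀

  D-square : ∀ {s t t' x} → Word n x → Valid n s → Valid n t' → Pull s t t' →
    Nested-or-apart s t' → s ≢ t' → D (t ∷ s ∷ x) + D x ≡ D (s ∷ x) + D (t' ∷ x)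
  D-square {s} {t} {t'} {x} vx vs vt' f c s≢t' =
    ≤-antisym
    (∑-mono₂ m (dist (t ∷ s ∷ x)) (dist x) (dist (s ∷ x)) (dist (t' ∷ x)) λ i → ≤-reflexive (eq i))
    (∑-mono₂ m (dist (s ∷ x)) (dist (t' ∷ x)) (dist (t ∷ s ∷ x)) (dist x) λ i → ≤-reflexive (sym (eq i)))
    where
    eq : ∀ i → dist (t ∷ s ∷ x) i + dist x i ≡ dist (s ∷ x) i + dist (t' ∷ x) i
    eq i = len-square (++⁺ vx (^w-all vu i)) vs vt' f c s≢t'

  D-convex : ∀ {s t x} → Word n x → Valid n s → Valid n t → ¬ Nested-or-apart s t →
    D (s ∷ x) + D (s ∷ x) ≤ D (t ∷ s ∷ x) + D x
  D-convex {s} {t} {x} vx vs vt ¬c =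
    ∑-mono₂ m (dist (s ∷ x)) (dist (s ∷ x)) (dist (t ∷ s ∷ x)) (dist x) λ i → len-convex (++⁺ vx (^w-all vu i)) vs vt ¬c

  -- The path starts at `y`; its first step is the last letter of the list.
  data Rise (y : List Letter) : List Letter → Set where
    []  : Rise y []
    _∷_ : ∀ {s P} → D (P ++ y) < D (s ∷ P ++ y) → Rise y P → Rise y (s ∷ P)

  rise-≤ : ∀ {y P} → Rise y P → D y ≤ D (P ++ y)
  rise-≤ [] = ≤-refl
  rise-≤ (l ∷ ls) = ≤-trans (rise-≤ ls) (<⇒≤ l)

  -- The path `v` from `x`, rearranged to follow `down` and then `up`. Of the descent only its net
  -- drop is recorded, which is what the induction in `descend` consumes.
  record Sorted (v x : List Letter) : Set where
    field
      {down up}  : List Letter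
      down-valid : Word n down
      up-valid   : Word n up
      factors    : v ≈[ n ] (up ++ down)
      rising     : Rise (down ++ x) up
      falling    : down ≡ [] ⊎ D (down ++ x) < D x

  regroup : ∀ {v} P N x → v ≈[ n ] (P ++ N) → (v ++ x) ≈[ n ] (P ++ N ++ x)
  regroup P N x e = ≈-trans (≈-++ʳ x e) (≈-reflexive (++-assoc P N x))

  -- A step down at the end of a rising path either cancels or can be moved to its start:
  -- it cannot meet a crossing, by convexity.
  push : ∀ {P y t} → Word n P → Word n y → Valid n t → Rise y P →
    D (t ∷ P ++ y) < D (P ++ y) → Sorted (t ∷ P) y
  push {[]} {t = t} _ _ vt [] l = record
    { down-valid = vt ∷ [] ; up-valid = [] ; factors = ≈-refl ; rising = [] ; falling = inj₂ l }
  push {s ∷ P} {y} {t} (vs ∷ vP) vy vt (r ∷ rs) l with corner vs vt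
  ... | same refl = record
    { down-valid = [] ; up-valid = vP
    ; factors = ≈-trans (≈-rel P (j1 vs)) (≈-reflexive (sym (++-identityʳ P)))
    ; rising = rs ; falling = inj₁ refl }
  ... | crossing ¬c = ⊥-elim (<⇒≱ (+-mono-< l r) (D-convex (++⁺ vP vy) vs vt ¬c))
  ... | square s' t' vs' vt' e f c s≢t' = record
    { down-valid = S.down-valid ; up-valid = vs' ∷ S.up-valid
    ; factors = ≈-trans (e P) (≈-cons s' S.factors)
    ; rising = subst₂ _<_ (D-resp (regroup S.up S.down y S.factors))
        (D-resp (≈-trans (e (P ++ y)) (≈-cons s' (regroup S.up S.down y S.factors)))) r' ∷ S.rising
    ; falling = S.falling }
    where
    -- The peak `s ∷ P ++ y` is traded for the opposite corner `t' ∷ P ++ y`. By the parallelogram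
    -- law that corner lies below both its neighbours, so `t'` can be pushed on through `P` and the
    -- final step `s'` rises.
    par : D (t ∷ s ∷ P ++ y) + D (P ++ y) ≡ D (s ∷ P ++ y) + D (t' ∷ P ++ y)
    par = D-square (++⁺ vP vy) vs vt' f c s≢t'
    l' : D (t' ∷ P ++ y) < D (P ++ y)
    l' = +-cancelˡ-< (D (s ∷ P ++ y)) _ _ (subst (_< D (s ∷ P ++ y) + D (P ++ y)) par
      (+-monoˡ-< (D (P ++ y)) l))
    r' : D (t' ∷ P ++ y) < D (t ∷ s ∷ P ++ y)
    r' = +-cancelʳ-< (D (P ++ y)) _ _ (subst (D (t' ∷ P ++ y) + D (P ++ y) <_)
      (trans (+-comm (D (t' ∷ P ++ y)) _) (sym par)) (+-monoʳ-< (D (t' ∷ P ++ y)) r))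
    module S = Sorted (push vP vy vt' rs l')

  -- By `D-step` each letter of `v` rises or falls. A rise extends `up`; a fall is pushed back
  -- through `up`, and what comes out joins `down`.
  sort : ∀ {v x} → Word n v → Word n x → Sorted v x
  sort [] vx = record
    { down-valid = [] ; up-valid = [] ; factors = ≈-refl ; rising = [] ; falling = inj₁ refl }
  sort {t ∷ v} {x} (vt ∷ vv) vx with sort vv vx
  ... | S with <-cmp (D (t ∷ Sorted.up S ++ Sorted.down S ++ x)) (D (Sorted.up S ++ Sorted.down S ++ x))
  ...   | tri≈ _ e _ = ⊥-elim (D-step t (Sorted.up S ++ Sorted.down S ++ x) e)
  ...   | tri> _ _ r = record
    { down-valid = S.down-valid ; up-valid = vt ∷ S.up-valid ; factors = ≈-cons t S.factors
    ; rising = r ∷ S.rising ; falling = S.falling }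
    where module S = Sorted S
  ...   | tri< l _ _ = record
    { down-valid = ++⁺ T.down-valid S.down-valid ; up-valid = T.up-valid
    ; factors = ≈-trans (≈-cons t S.factors) (≈-trans (≈-++ʳ S.down T.factors)
        (≈-reflexive (++-assoc T.up T.down S.down)))
    ; rising = subst (λ y → Rise y T.up) (sym (++-assoc T.down S.down x)) T.rising
    ; falling = combine T.falling S.falling }
    where
    module S = Sorted S
    module T = Sorted (push S.up-valid (++⁺ S.down-valid vx) vt S.rising l)
    combine : T.down ≡ [] ⊎ D (T.down ++ S.down ++ x) < D (S.down ++ x) →
      S.down ≡ [] ⊎ D (S.down ++ x) < D x →
      T.down ++ S.down ≡ [] ⊎ D ((T.down ++ S.down) ++ x) < D x
    combine (inj₁ e) (inj₁ f) = inj₁ (cong₂ _++_ e f)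
    combine (inj₁ e) (inj₂ k) = inj₂ (subst (λ z → D ((z ++ S.down) ++ x) < D x) (sym e) k)
    combine (inj₂ h) f = inj₂ (subst (λ z → D z < D x) (sym (++-assoc T.down S.down x))
      (<-≤-trans h (weaken f)))
      where
      weaken : S.down ≡ [] ⊎ D (S.down ++ x) < D x → D (S.down ++ x) ≤ D x
      weaken (inj₁ f) = ≤-reflexive (cong (λ z → D (z ++ x)) f)
      weaken (inj₂ k) = <⇒≤ k

  -- The word `c` represents the conjugate `x u x⁻¹`, and the induction is on `D x`.
  descend : ∀ {x c} → Acc _<_ (D x) → Word n x → Word n c → (c ++ x) ≈[ n ] (x ++ u) → u ≈[ n ] []
  descend {x} {c} (acc rec) vx vc e with sort vc vx
  ... | record { down = N ; up = P ; down-valid = vN ; up-valid = vP ; factors = f ; falling = inj₂ l } =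
    -- As `c = P N`, the conjugate of `u` at the lower point `N x` is `N P`.
    descend (rec l) (++⁺ vN vx) (++⁺ vN vP)
      (≈-trans (≈-reflexive (++-assoc N P (N ++ x)))
        (≈-trans (≈-++ˡ N (≈-trans (≈-sym (regroup P N x f)) e)) (≈-reflexive (sym (++-assoc N x u)))))
  ... | record { up = [] ; factors = f ; falling = inj₁ refl } =
    ≈-cancelˡ vx (≈-trans (≈-trans (≈-sym e) (≈-++ʳ x f)) (≈-reflexive (sym (++-identityʳ x))))
  ... | record { up = s ∷ P ; factors = f ; rising = r ∷ rs ; falling = inj₁ refl } =
    -- By `D-period` the endpoint `x u` has the value `D x`, so no nonempty rise leads there from
    -- `x`.
    ⊥-elim (<-irrefl (trans (sym (D-period x)) (trans (sym (D-resp e)) (D-resp (regroup (s ∷ P) [] x f))))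
      (≤-<-trans (rise-≤ rs) r))

  trivial : u ≈[ n ] []
  trivial = descend {[]} {u} (<-wellFounded _) [] vu (≈-reflexive (++-identityʳ u))

-- Doubling the order of an element.

^w-double : ∀ x i → x ^w (i + i) ≡ (x ++ x) ^w i
^w-double x zero = refl
^w-double x (suc i) = trans (cong (λ k → x ++ x ^w k) (+-suc i i))
  (trans (cong (λ z → x ++ x ++ z) (^w-double x i)) (sym (++-assoc x x _)))

map-^w : ∀ (f : Letter → Letter) x i → map f (x ^w i) ≡ map f x ^w i
map-^w f x zero = refl
map-^w f x (suc i) = trans (map-++ f x (x ^w i)) (cong (map f x ++_) (map-^w f x i))

valid-mono : ∀ {m n s} → m ≤ n → Valid m s → Valid n s
valid-mono m≤n (a , b , c) = a , b , ≤-trans c m≤n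

-- J_{2M} contains (J_M × J_M) ⋊ Z/2, where s = s_{1,2M} swaps the two factors.
module Doubling (M n : ℕ) (1≤M : 1 ≤ M) (2M≤n : M + M ≤ n) where

  open Congruence n

  s : Letter
  s = 1 , M + M

  s-valid : Valid n s
  s-valid = ≤-refl , +-mono-≤ 1≤M 1≤M , 2M≤n

  High : Letter → Set
  High t = Valid n t × M < proj₁ t

  mirror : List Letter → List Letter
  mirror = map (reflect s)

  reflect-high : ∀ {t} → Valid M t → High (reflect s t)
  reflect-high {m , r} (1≤m , m<r , r≤M) =
    reflect-valid s-valid 1≤m m<r (≤-trans r≤M (m≤m+n M M)) ,
    subst (_≤ suc (M + M) ∸ r) (m+n∸n≡m (suc M) M) (∸-monoʳ-≤ (suc (M + M)) r≤M)

  mirror-high : ∀ {x} → Word M x → All High (mirror x)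
  mirror-high [] = []
  mirror-high (v ∷ vs) = reflect-high v ∷ mirror-high vs

  s-mirror : ∀ {x} → Word M x → ∀ y → (s ∷ x ++ y) ≈[ n ] (mirror x ++ s ∷ y)
  s-mirror [] y = ≈-refl
  s-mirror {t ∷ x} (v@(1≤m , _ , r≤M) ∷ vs) y = ≈-trans
    (≈-rel (x ++ y) (j3 s-valid (valid-mono (≤-trans (m≤m+n M M) 2M≤n) v) 1≤m (≤-trans r≤M (m≤m+n M M))))
    (≈-cons (reflect s t) (s-mirror vs y))

  letter-commute : ∀ {t y} → Valid M t → All High y → ∀ z → (t ∷ y ++ z) ≈[ n ] (y ++ t ∷ z)
  letter-commute v [] z = ≈-refl
  letter-commute {t} {t' ∷ y} v@(_ , _ , r≤M) ((v' , M<p) ∷ hs) z = ≈-trans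
    (≈-rel (y ++ z) (j2 (valid-mono (≤-trans (m≤m+n M M) 2M≤n) v) v' (inj₁ (≤-<-trans r≤M M<p))))
    (≈-cons t' (letter-commute v hs z))

  commute : ∀ {x y} → Word M x → All High y → ∀ z → (x ++ y ++ z) ≈[ n ] (y ++ x ++ z)
  commute [] h z = ≈-refl
  commute {t ∷ x} {y} (v ∷ vs) h z = ≈-trans (≈-cons t (commute vs h z)) (letter-commute v h (x ++ z))

  pow-product : ∀ {x y} → Word M x → All High y → ∀ i → ((y ++ x) ^w i) ≈[ n ] (y ^w i ++ x ^w i)
  pow-product vx hy zero = ≈-refl
  pow-product {x} {y} vx hy (suc i) = ≈-trans (≈-++ˡ (y ++ x) (pow-product vx hy i))
    (≈-trans (≈-reflexive (++-assoc y x _))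
      (≈-trans (≈-++ˡ y (commute vx (^w-all hy i) (x ^w i)))
        (≈-reflexive (sym (++-assoc y (y ^w i) _)))))

  square-root : ∀ {x} → Word M x → (s ∷ x ++ s ∷ x) ≈[ n ] (mirror x ++ x)
  square-root {x} vx = ≈-trans (s-mirror vx (s ∷ x)) (≈-++ˡ (mirror x) (≈-rel x (j1 s-valid)))

  ≈-^w : ∀ {x y} → x ≈[ n ] y → ∀ i → (x ^w i) ≈[ n ] (y ^w i)
  ≈-^w e zero = ≈-refl
  ≈-^w e (suc i) = ≈-++ e (≈-^w e i)

  even-power : ∀ {x} → Word M x → ∀ i → ((s ∷ x) ^w (i + i)) ≈[ n ] (mirror (x ^w i) ++ x ^w i)
  even-power {x} vx i = ≈-trans (≈-reflexive (^w-double (s ∷ x) i))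
    (≈-trans (≈-^w (square-root vx) i)
      (≈-trans (pow-product vx (mirror-high vx) i)
        (≈-reflexive (cong (_++ x ^w i) (sym (map-^w (reflect s) x i))))))

  -- `mirror x` represents the conjugate `s x s`.
  mirror-trivial : ∀ {x} → Word M x → x ≈[ n ] [] → mirror x ≈[ n ] []
  mirror-trivial {x} vx e = ≈-trans
    (≈-sym (≈-trans (≈-++ˡ (mirror x) (≈-rel [] (j1 s-valid))) (≈-reflexive (++-identityʳ _))))
    (≈-trans (≈-sym (s-mirror vx (s ∷ [])))
      (≈-trans (≈-cons s (≈-++ʳ (s ∷ []) e)) (≈-rel [] (j1 s-valid))))

  double-trivial : ∀ {x i} → Word M x → (x ^w i) ≈[ n ] [] → ((s ∷ x) ^w (i + i)) ≈[ n ] []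
  double-trivial {i = i} vx e = ≈-trans (even-power vx i)
    (≈-++ (mirror-trivial (^w-all vx i) e) e)

  π-low : ∀ {x y} → Word M x → In (1 , M) y → In (1 , M) (π x y)
  π-low [] y∈ = y∈
  π-low {t ∷ x} {y} ((1≤m , _ , r≤M) ∷ vs) y∈ =
    in-σ-fixed {t} (inj₁ (1≤m , r≤M)) (π x y) (π-low vs y∈)

  π-fixes-low : ∀ {x y} → All High x → y ≤ M → π x y ≡ y
  π-fixes-low [] y≤M = refl
  π-fixes-low {t ∷ x} ((_ , M<p) ∷ hs) y≤M = trans (cong (σ t) (π-fixes-low hs y≤M))
    (σ-outside λ (p≤y , _) → <⇒≱ M<p (≤-trans p≤y y≤M))

  -- The even power is the product of `x ^w i` and its mirror image, and the latter fixes every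
  -- point up to `M`.
  π-even : ∀ {x y} → Word M x → ∀ i → In (1 , M) y → π ((s ∷ x) ^w (i + i)) y ≡ π (x ^w i) y
  π-even {x} {y} vx i y∈ = trans (π-resp (even-power vx i) y)
    (trans (π-++ (mirror (x ^w i)) (x ^w i) y)
      (π-fixes-low (mirror-high (^w-all vx i)) (proj₂ (π-low (^w-all vx i) y∈))))

  σ-high : ∀ {y} → In (1 , M) y → M < σ s y
  σ-high {y} (1≤y , y≤M) = subst (M <_) (sym (σ-inside {s} (1≤y , ≤-trans y≤M (m≤m+n M M))))
    (subst (_≤ suc (M + M) ∸ y) (m+n∸n≡m (suc M) M) (∸-monoʳ-≤ (suc (M + M)) y≤M))

  -- The even power and then `x` keep `y` in the lower half; the remaining `s` sends it to the upper
  -- half.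
  π-odd : ∀ {x y} → Word M x → ∀ i → In (1 , M) y → M < π ((s ∷ x) ^w suc (i + i)) y
  π-odd {x} {y} vx i y∈ = subst (M <_) (cong (σ s) (sym (trans
      (π-++ x ((s ∷ x) ^w (i + i)) y) (cong (π x) (π-even vx i y∈)))))
    (σ-high (π-low vx (π-low (^w-all vx i) y∈)))

-- The words `s_{1,2^k} ⋯ s_{1,4} s_{1,2}`, of order `2^k`.

cycle : ℕ → List Letter
cycle zero = []
cycle (suc k) = (1 , 2 ^ k + 2 ^ k) ∷ cycle k

2^suc : ∀ k → 2 ^ suc k ≡ 2 ^ k + 2 ^ k
2^suc k = cong (2 ^ k +_) (+-identityʳ (2 ^ k))

cycle-valid : ∀ k → Word (2 ^ k) (cycle k)
cycle-valid zero = []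
cycle-valid (suc k) = subst (λ m → Word m (cycle (suc k))) (sym (2^suc k))
  ((≤-refl , +-mono-≤ (m^n>0 2 k) (m^n>0 2 k) , ≤-refl)
    ∷ All.map (valid-mono (m≤m+n (2 ^ k) (2 ^ k))) (cycle-valid k))

cycle-torsion : ∀ k n → 2 ^ k ≤ n → (cycle k ^w (2 ^ k)) ≈[ n ] []
cycle-torsion zero n _ = Congruence.≈-refl n
cycle-torsion (suc k) n h = subst (λ m → (cycle (suc k) ^w m) ≈[ n ] []) (sym (2^suc k))
  (double-trivial {i = 2 ^ k} (cycle-valid k) (cycle-torsion k n (≤-trans (m≤m+n (2 ^ k) (2 ^ k)) 2M≤n)))
  where
  2M≤n : 2 ^ k + 2 ^ k ≤ n
  2M≤n = subst (_≤ n) (2^suc k) h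
  open Doubling (2 ^ k) n (m^n>0 2 k) 2M≤n

halves : ∀ j → ∃ λ i → j ≡ i + i ⊎ j ≡ suc (i + i)
halves zero = 0 , inj₁ refl
halves (suc j) with halves j
... | i , inj₁ e = i , inj₂ (cong suc e)
... | i , inj₂ e = suc i , inj₁ (cong suc (trans e (sym (+-suc i i))))

-- The order is bounded below in the symmetric group, by induction on `k`: an odd power moves `1`
-- out of the lower half, and the power `i + i` acts on the lower half as the `i`-th power of the
-- shorter word.
cycle-moves : ∀ k j → 0 < j → j < 2 ^ k →
  ¬ (∀ y → In (1 , 2 ^ k) y → π (cycle k ^w j) y ≡ y)
cycle-moves zero (suc j) _ (s≤s ()) _
cycle-moves (suc k) j 0<j j<2M fixed with halves j
... | zero , inj₁ refl = <-irrefl refl 0<j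
... | suc i' , inj₁ refl = cycle-moves k i (s≤s z≤n) i<M
    λ y y∈ → trans (sym (π-even (cycle-valid k) i y∈)) (fixed y (widen y∈))
  where
  -- The claim concerns permutations only and does not mention the rank, so the least admissible
  -- rank is taken.
  open Doubling (2 ^ k) (2 ^ k + 2 ^ k) (m^n>0 2 k) ≤-refl
  i : ℕ
  i = suc i'
  i<M : i < 2 ^ k
  i<M = ≰⇒> λ M≤i → <⇒≱ (subst (i + i <_) (2^suc k) j<2M) (+-mono-≤ M≤i M≤i)
  widen : ∀ {y} → In (1 , 2 ^ k) y → In (1 , 2 ^ suc k) y
  widen (a , b) = a , ≤-trans b (m≤m+n (2 ^ k) _)
... | i , inj₂ refl = <⇒≱ (subst (2 ^ k <_) (fixed 1 (≤-refl , m^n>0 2 (suc k)))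
    (π-odd (cycle-valid k) i (≤-refl , m^n>0 2 k))) (m^n>0 2 k)
  where
  open Doubling (2 ^ k) (2 ^ k + 2 ^ k) (m^n>0 2 k) ≤-refl

cycle-order : ∀ k n → 2 ^ k ≤ n → HasOrder n (cycle k) (2 ^ k)
cycle-order k n h = m^n>0 2 k , cycle-torsion k n h ,
  λ j 0<j j<2^k e → cycle-moves k j 0<j j<2^k λ y _ → Congruence.π-resp n e y

theoremB : ((n : ℕ) → 2 ≤ n → (w : List Letter) → Word n w → (m : ℕ) →
    HasOrder n w m → OddN m → m ≡ 1)
    × ((k : ℕ) → 1 ≤ k → ∃ λ N → (n : ℕ) → 2 ≤ n → N ≤ n →
    Σ (List Letter) λ w → Word n w × HasOrder n w (2 ^ k))
theoremB = no-odd-torsion , λ k _ → 2 ^ k , λ n _ 2^k≤n →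
  cycle k , All.map (valid-mono 2^k≤n) (cycle-valid k) , cycle-order k n 2^k≤n
  where
  no-odd-torsion : (n : ℕ) → 2 ≤ n → (w : List Letter) → Word n w → (m : ℕ) →
    HasOrder n w m → OddN m → m ≡ 1
  no-odd-torsion n _ w vw _ _ (zero , refl) = refl
  no-odd-torsion n _ w vw _ (_ , torsion , minimal) (suc j , refl) =
    -- `w` is trivial, so minimality fails at exponent `1`, the order being at least `3` here.
    ⊥-elim (minimal 1 (s≤s z≤n) (s≤s (s≤s z≤n))
      (≈-trans (≈-reflexive (++-identityʳ w)) (OddOrder.trivial n vw (suc j) torsion)))
    where open Congruence n using (≈-trans; ≈-reflexive)
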